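{- Let $G=(V,E)$ be a graph and $v\in V$. Then $v\in\mathrm{core}(G)$ if and only if one of the following holds: (1) $v$ is isolated; (2) $\gamma(G-v)>\gamma(G)$; (3) $\gamma(G-v)=\gamma(G)$ and every neighbor $w\in N(v)$ satisfies $w\in\mathrm{anticore}(G-v)$.
   Context: All graphs are finite, simple and undirected. $N(v)$ is the set of neighbors of $v$. $\gamma(G)$ is the domination number (minimum size of a dominating set); a minimum dominating set (mds) is a dominating set of size $\gamma(G)$. For a graph $H$, $\mathrm{core}(H)$ is the set of vertices belonging to every mds of $H$, $\mathrm{corona}(H)$ the set of vertices belonging to at least one mds of $H$, and $\mathrm{anticore}(H)=V(H)\setminus\mathrm{corona}(H)$. $G-v$ is the graph obtained by deleting $v$. A vertex is isolated if it has no neighbors. -}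

module Defs where

open import Data.Fin.Base using (Fin; punchIn)
open import Data.Fin.Properties using (any?; all?)
open import Data.Fin.Subset using (Subset; _∈_; ∣_∣; ⊤)
open import Data.Fin.Subset.Properties using (_∈?_; ∈⊤; anySubset?)
open import Data.Nat.Base using (ℕ; suc; _≤_; _<_)
open import Data.Nat.Induction using (Acc; acc; <-wellFounded)
open import Data.Nat.Properties using (_<?_; ≮⇒≥)
open import Data.Product using (∃-syntax; _×_; _,_; proj₁)
open import Data.Sum using (_⊎_; inj₁)
open import Level using (0ℓ)
open import Relation.Binary.Core using (Rel)
open import Relation.Binary.Definitions using (Decidable; Irreflexive; Symmetric)
open import Relation.Binary.PropositionalEquality using (_≡_; refl)
open import Relation.Nullary using (Dec; yes; no)
open import Relation.Nullary.Decidable using (_×-dec_; _⊎-dec_)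
open import Relation.Unary using (Pred; ∁; Empty)

private
  variable
    n : ℕ

-- Decidability of adjacency is automatic classically; constructively it
-- is what makes the minimum defining γ exist.
record Graph (n : ℕ) : Set₁ where
  field
    Adj    : Rel (Fin n) 0ℓ
    sym    : Symmetric Adj
    irrefl : Irreflexive _≡_ Adj
    adj?   : Decidable Adj

open Graph

N : Graph n → Fin n → Pred (Fin n) 0ℓ
N G v w = Adj G v w

Isolated : Graph n → Pred (Fin n) 0ℓ
Isolated G v = Empty (N G v)

-- The vertices of G - v are renumbered: vertex w of G - v is vertex
-- punchIn v w of G, and punchIn v is a bijection from Fin n onto the
-- elements of Fin (suc n) other than v.
infixl 6 _-_

_-_ : Graph (suc n) → Fin (suc n) → Graph n
G - v = record
  { Adj    = λ x y → Adj G (punchIn v x) (punchIn v y)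
  ; sym    = sym G
  ; irrefl = λ { refl → irrefl G refl }
  ; adj?   = λ x y → adj? G (punchIn v x) (punchIn v y)
  }

IsDominating : Graph n → Pred (Subset n) 0ℓ
IsDominating G S = ∀ u → u ∈ S ⊎ ∃[ w ] (w ∈ S × Adj G u w)

isDominating? : (G : Graph n) (S : Subset n) → Dec (IsDominating G S)
isDominating? G S =
  all? λ u → (u ∈? S) ⊎-dec any? λ w → (w ∈? S) ×-dec adj? G u w

smallestDominating : (G : Graph n) →
  ∃[ S ] (IsDominating G S × (∀ T → IsDominating G T → ∣ S ∣ ≤ ∣ T ∣))
smallestDominating G = go ⊤ (λ _ → inj₁ ∈⊤) (<-wellFounded _)
  where
  go : ∀ S → IsDominating G S → Acc _<_ ∣ S ∣ →
       ∃[ S′ ] (IsDominating G S′ × (∀ T → IsDominating G T → ∣ S′ ∣ ≤ ∣ T ∣))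
  go S domS (acc rec)
    with anySubset? (λ T → isDominating? G T ×-dec (∣ T ∣ <? ∣ S ∣))
  ... | yes (T , domT , T<S) = go T domT (rec T<S)
  ... | no  none             = S , domS , λ T domT → ≮⇒≥ λ T<S → none (T , domT , T<S)

γ : Graph n → ℕ
γ G = ∣ proj₁ (smallestDominating G) ∣

IsMDS : Graph n → Pred (Subset n) 0ℓ
IsMDS G S = IsDominating G S × ∣ S ∣ ≡ γ G

core : Graph n → Pred (Fin n) 0ℓ
core G v = ∀ S → IsMDS G S → v ∈ S

corona : Graph n → Pred (Fin n) 0ℓ
corona G v = ∃[ S ] (IsMDS G S × v ∈ S)

anticore : Graph n → Pred (Fin n) 0ℓ
anticore G = ∁ (corona G)

{-# OPTIONS --safe #-}
module Submission where

open import Defs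
open import Data.Fin.Base using (Fin; punchIn; punchOut; zero; suc)
open import Data.Fin.Properties using (any?; _≟_; punchIn-punchOut)
open import Data.Fin.Subset
  using (Subset; inside; outside; ∣_∣; ⁅_⁆; _∪_; _⊆_; _∉_) renaming (_∈_ to _∈ₛ_)
open import Data.Fin.Subset.Properties
  using (_∈?_; ∪-identityʳ; p⊆p∪q; q⊆p∪q; x∈⁅x⁆)
open import Data.Nat.Base using (ℕ; suc; _>_; _<_; _≤_; s≤s)
open import Data.Nat.Properties
  using (<-cmp; ≤-refl; ≤-reflexive; ≤-trans; <⇒≱; n≤1+n)
open import Data.Product using (_×_; _,_; proj₁; proj₂; ∃-syntax; map₂; map₁)
open import Data.Sum using (_⊎_; inj₁; inj₂; map)
open import Data.Vec.Base using (insertAt; removeAt; lookup; _∷_)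
open import Data.Vec.Properties
  using (insertAt-lookup; insertAt-punchIn; insertAt-removeAt; []=⇒lookup; lookup⇒[]=)
open import Function.Base using (case_of_)
open import Function.Bundles using (_⇔_; mk⇔)
open import Relation.Binary.Definitions using (tri<; tri≈; tri>)
open import Relation.Binary.PropositionalEquality
  using (_≡_; refl; sym; trans; cong; subst)
open import Relation.Nullary using (yes; no; contradiction)
open import Relation.Nullary.Decidable using (decidable-stable)
open import Relation.Unary using (_∈_)

-- Write γ = γ(G). The dominating sets of G avoiding v are exactly the
-- dominating sets of G - v that meet N(v). So a minimum dominating set of G
-- avoiding v is a dominating set of G - v of size γ meeting N(v), which each
-- of (1)-(3) rules out. Conversely, if v is not isolated and γ(G - v) < γ,
-- adding a neighbour of v to a minimum dominating set of G - v yields a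
-- dominating set of G of size at most γ avoiding v; and if γ(G - v) = γ, a
-- minimum dominating set of G - v that meets N(v) already is one.

private
  variable
    n : ℕ

∣p∪⁅x⁆∣≤1+∣p∣ : (p : Subset n) (x : Fin n) → ∣ p ∪ ⁅ x ⁆ ∣ ≤ suc ∣ p ∣
∣p∪⁅x⁆∣≤1+∣p∣ (inside  ∷ p) zero    rewrite ∪-identityʳ p = n≤1+n _
∣p∪⁅x⁆∣≤1+∣p∣ (outside ∷ p) zero    rewrite ∪-identityʳ p = ≤-refl
∣p∪⁅x⁆∣≤1+∣p∣ (inside  ∷ p) (suc x) = s≤s (∣p∪⁅x⁆∣≤1+∣p∣ p x)
∣p∪⁅x⁆∣≤1+∣p∣ (outside ∷ p) (suc x) = ∣p∪⁅x⁆∣≤1+∣p∣ p x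

-- Matching on this view turns a vertex other than `v` into literal `punchIn v x`, the form in which
-- adjacency in `G` is by definition adjacency in `G - v`.
data PunchInView (v : Fin (suc n)) : Fin (suc n) → Set where
  hole    : PunchInView v v
  punched : (x : Fin n) → PunchInView v (punchIn v x)

punchInView : (v u : Fin (suc n)) → PunchInView v u
punchInView v u with v ≟ u
... | yes refl = hole
... | no v≢u   = subst (PunchInView v) (punchIn-punchOut v≢u) (punched (punchOut v≢u))

-- The image of `D` under `punchIn v`, with subsets as vectors of membership bits.
punchInₛ : Fin (suc n) → Subset n → Subset (suc n)
punchInₛ v D = insertAt D v outside

∣punchInₛ∣ : (v : Fin (suc n)) (D : Subset n) → ∣ punchInₛ v D ∣ ≡ ∣ D ∣
∣punchInₛ∣ zero    D             = refl
∣punchInₛ∣ (suc v) (inside  ∷ D) = cong suc (∣punchInₛ∣ v D)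
∣punchInₛ∣ (suc v) (outside ∷ D) = ∣punchInₛ∣ v D

v∉punchInₛ : (v : Fin (suc n)) (D : Subset n) → v ∉ punchInₛ v D
v∉punchInₛ v D v∈ with () ← trans (sym (insertAt-lookup D v outside)) ([]=⇒lookup v∈)

∈-punchInₛ⁺ : (v : Fin (suc n)) {D : Subset n} {x : Fin n} →
              x ∈ₛ D → punchIn v x ∈ₛ punchInₛ v D
∈-punchInₛ⁺ v {D} {x} x∈D =
  lookup⇒[]= _ _ (trans (insertAt-punchIn D v outside x) ([]=⇒lookup x∈D))

∈-punchInₛ⁻ : (v : Fin (suc n)) {D : Subset n} {x : Fin n} →
              punchIn v x ∈ₛ punchInₛ v D → x ∈ₛ D
∈-punchInₛ⁻ v {D} {x} x∈ =
  lookup⇒[]= _ _ (trans (sym (insertAt-punchIn D v outside x)) ([]=⇒lookup x∈))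

v∉S⇒S≡punchInₛ : (v : Fin (suc n)) (S : Subset (suc n)) →
                 v ∉ S → ∃[ D ] punchInₛ v D ≡ S
-- Abstracting `lookup S v` also replaces the reinserted bit in the type of `insertAt-removeAt S v`,
-- so in the `outside` case that equation is the claim.
v∉S⇒S≡punchInₛ v S v∉S with lookup S v in eq | insertAt-removeAt S v
... | inside  | _   = contradiction (lookup⇒[]= v S eq) v∉S
... | outside | D≡S = removeAt S v , D≡S

γ-minimal : (G : Graph n) {S : Subset n} → IsDominating G S → γ G ≤ ∣ S ∣
γ-minimal G = proj₂ (proj₂ (smallestDominating G)) _

minimumDominating : (G : Graph n) → ∃[ S ] IsMDS G S
minimumDominating G = _ , proj₁ (proj₂ (smallestDominating G)) , refl

IsDominating-⊆ : (G : Graph n) {S T : Subset n} →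
                 S ⊆ T → IsDominating G S → IsDominating G T
IsDominating-⊆ G S⊆T dom u = map S⊆T (map₂ (map₁ S⊆T)) (dom u)

Meets : Graph (suc n) → Fin (suc n) → Subset n → Set
Meets G v D = ∃[ w ] (w ∈ₛ D × punchIn v w ∈ N G v)

dominating-punchInₛ⁺ : (G : Graph (suc n)) (v : Fin (suc n)) {D : Subset n} →
  IsDominating (G - v) D → Meets G v D → IsDominating G (punchInₛ v D)
dominating-punchInₛ⁺ G v dom (w , w∈D , vw) u with punchInView v u
... | hole      = inj₂ (punchIn v w , ∈-punchInₛ⁺ v w∈D , vw)
... | punched x = map (∈-punchInₛ⁺ v)
                      (λ (y , y∈D , xy) → punchIn v y , ∈-punchInₛ⁺ v y∈D , xy) (dom x)

-- The vertex `u` is arbitrary to serve two uses: `u = punchIn v x` gives domination in `G - v`, and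
-- `u = v` gives `Meets`.
neighbour-punchInₛ⁻ : (G : Graph (suc n)) (v : Fin (suc n)) {D : Subset n} {u : Fin (suc n)} →
  ∃[ w ] (w ∈ₛ punchInₛ v D × w ∈ N G u) →
  ∃[ x ] (x ∈ₛ D × punchIn v x ∈ N G u)
neighbour-punchInₛ⁻ G v (w , w∈ , uw) with punchInView v w
... | hole      = contradiction w∈ (v∉punchInₛ v _)
... | punched x = x , ∈-punchInₛ⁻ v w∈ , uw

dominating-punchInₛ⁻ : (G : Graph (suc n)) (v : Fin (suc n)) {D : Subset n} →
  IsDominating G (punchInₛ v D) → IsDominating (G - v) D × Meets G v D
dominating-punchInₛ⁻ G v {D} dom =
  (λ x → map (∈-punchInₛ⁻ v) (neighbour-punchInₛ⁻ G v) (dom (punchIn v x))) , meets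
  where
  meets : Meets G v D
  meets with dom v
  ... | inj₁ v∈ = contradiction v∈ (v∉punchInₛ v D)
  ... | inj₂ p  = neighbour-punchInₛ⁻ G v p

-- Viewed in `G`, `D` is a dominating set without `v`: at size `γ G` it would be an mds missing a
-- core vertex, and a smaller size contradicts minimality.
core⇒γ< : (G : Graph (suc n)) (v : Fin (suc n)) {D : Subset n} → v ∈ core G →
          IsDominating (G - v) D → Meets G v D → γ G < ∣ D ∣
core⇒γ< G v {D} v∈core dom meets with <-cmp (γ G) ∣ D ∣
... | tri< γ<D _ _ = γ<D
... | tri≈ _ γ≡D _ = contradiction
        (v∈core _ (dominating-punchInₛ⁺ G v dom meets , trans (∣punchInₛ∣ v D) (sym γ≡D)))
        (v∉punchInₛ v D)
... | tri> _ _ D<γ = contradiction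
        (subst (γ G ≤_) (∣punchInₛ∣ v D) (γ-minimal G (dominating-punchInₛ⁺ G v dom meets)))
        (<⇒≱ D<γ)

core⇒γ≤ : (G : Graph (suc n)) (v : Fin (suc n)) {w : Fin n} → v ∈ core G →
          punchIn v w ∈ N G v → γ G ≤ γ (G - v)
core⇒γ≤ G v {w} v∈core vw with D , dom , D≡γ ← minimumDominating (G - v)
  -- Adding `w` makes `D` meet `N G v` at the cost of at most one element, which the strict bound of
  -- `core⇒γ<` absorbs.
  with s≤s γ≤D ← ≤-trans
         (core⇒γ< G v v∈core (IsDominating-⊆ (G - v) (p⊆p∪q ⁅ w ⁆) dom)
                             (w , q⊆p∪q D ⁅ w ⁆ (x∈⁅x⁆ w) , vw))
         (∣p∪⁅x⁆∣≤1+∣p∣ D w) = subst (γ G ≤_) D≡γ γ≤D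

avoidingMDS : (G : Graph (suc n)) (v : Fin (suc n)) {S : Subset (suc n)} →
  IsMDS G S → v ∉ S → ∃[ D ] (IsDominating (G - v) D × Meets G v D × ∣ D ∣ ≡ γ G)
avoidingMDS G v {S} (dom , S≡γ) v∉S with D , refl ← v∉S⇒S≡punchInₛ v S v∉S
  with domD , meets ← dominating-punchInₛ⁻ G v dom =
  D , domD , meets , trans (sym (∣punchInₛ∣ v D)) S≡γ

theorem5 : ∀ (n : ℕ) (G : Graph (suc n)) (v : Fin (suc n)) →
    v ∈ core G ⇔
    (Isolated G v
    ⊎ γ (G - v) > γ G
    ⊎ (γ (G - v) ≡ γ G
    × (∀ (w : Fin n) → punchIn v w ∈ N G v → w ∈ anticore (G - v))))
theorem5 n G v = mk⇔ to from
  where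
  Conditions : Set
  Conditions =
    Isolated G v
    ⊎ γ (G - v) > γ G
    ⊎ (γ (G - v) ≡ γ G
    × (∀ (w : Fin n) → punchIn v w ∈ N G v → w ∈ anticore (G - v)))

  to : v ∈ core G → Conditions
  to v∈core with any? (Graph.adj? G v)
  ... | no isolated = inj₁ λ w vw → isolated (w , vw)
  ... | yes (u , vu) with punchInView v u
  -- Without loops, a neighbour of `v` is a vertex of `G - v`.
  ...   | hole      = contradiction vu (Graph.irrefl G refl)
  ...   | punched _ with <-cmp (γ G) (γ (G - v))
  ...     | tri< γ<γ′ _ _ = inj₂ (inj₁ γ<γ′)
  ...     | tri> _ _ γ>γ′ = contradiction (core⇒γ≤ G v v∈core vu) (<⇒≱ γ>γ′)
  ...     | tri≈ _ γ≡γ′ _ = inj₂ (inj₂ (sym γ≡γ′ ,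
            -- An mds of `G - v` containing `w` meets `N G v`, so it would have more than `γ G`
            -- elements, yet its size is `γ (G - v)`, equal to `γ G`.
            λ w vw (D , (dom , D≡γ′) , w∈D) →
              <⇒≱ (core⇒γ< G v v∈core dom (w , w∈D , vw))
                  (≤-reflexive (trans D≡γ′ (sym γ≡γ′)))))

  from : Conditions → v ∈ core G
  -- Membership in `S` is decidable, so refuting `v ∉ S` suffices.
  from conditions S mds = decidable-stable (v ∈? S) λ v∉S →
    let D , dom , (w , w∈D , vw) , D≡γ = avoidingMDS G v mds v∉S in
    case conditions of λ where
      (inj₁ isolated)             → isolated _ vw
      (inj₂ (inj₁ γ<γ′))          →
        <⇒≱ γ<γ′ (subst (γ (G - v) ≤_) D≡γ (γ-minimal (G - v) dom))
      (inj₂ (inj₂ (γ′≡γ , anti))) →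
        -- Equal domination numbers make `D` an mds of `G - v`, which puts its element `w` in the
        -- corona.
        anti w vw (D , (dom , trans D≡γ (sym γ′≡γ)) , w∈D)
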